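{- Let $p$ be a prime, let $b\ge2$ be an integer, let $p=\sum_{i=0}^n a_ib^i$ be the base-$b$ expansion of $p$ with integer digits $0\le a_i\le b-1$, and let $f(x)=a_nx^n+\cdots+a_1x+a_0\in\mathbb{Z}[x]$. If $f(x)$ is a non-constant irreducible polynomial, then $f(x)$ is proper.
   Context: A non-constant polynomial in $\mathbb{Z}[x]$ is called proper if its values at integers are relatively prime, i.e. the greatest common divisor of all the values $f(n)$, $n\in\mathbb{Z}$, is $1$. (By the generalized Cohn irreducibility criterion, a known result, such an $f$ is always irreducible in $\mathbb{Z}[x]$.) -}

module Defs where

open import Algebra.Bundles.Raw using (RawSemiring)
open import Data.Digit using (Expansion)
open import Data.Fin.Base using (toℕ)
open import Data.Integer.Base using (ℤ; +_; 0ℤ; 1ℤ) renaming (_+_ to _+ᶻ_; _*_ to _*ᶻ_)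
open import Data.Integer.Divisibility using (_∣_)
open import Data.List.Base using (List; []; _∷_; map)
open import Data.Nat.Base using (ℕ; zero; suc)
open import Data.Product.Base using (_×_; ∃)
open import Level using (0ℓ)
open import Relation.Binary.PropositionalEquality.Core using (_≡_)
open import Relation.Nullary.Negation.Core using (¬_)

-- Coefficient lists, constant term first. Trailing zeros are allowed, so
-- equality of polynomials is _≈_ below and not _≡_.
ℤ[x] : Set
ℤ[x] = List ℤ

coeff : ℤ[x] → ℕ → ℤ
coeff []      _       = 0ℤ
coeff (a ∷ f) zero    = a
coeff (a ∷ f) (suc i) = coeff f i

infix 4 _≈_
_≈_ : ℤ[x] → ℤ[x] → Set
f ≈ g = ∀ i → coeff f i ≡ coeff g i

const : ℤ → ℤ[x]
const c = c ∷ []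

infixl 6 _+_
_+_ : ℤ[x] → ℤ[x] → ℤ[x]
[]      + g       = g
(a ∷ f) + []      = a ∷ f
(a ∷ f) + (b ∷ g) = (a +ᶻ b) ∷ (f + g)

-- (a + x f) g = a g + x (f g)
infixl 7 _*_
_*_ : ℤ[x] → ℤ[x] → ℤ[x]
[]      * g = []
(a ∷ f) * g = map (a *ᶻ_) g + (0ℤ ∷ (f * g))

eval : ℤ[x] → ℤ → ℤ
eval []      m = 0ℤ
eval (a ∷ f) m = a +ᶻ m *ᶻ eval f m

ℤ[x]-rawSemiring : RawSemiring 0ℓ 0ℓ
ℤ[x]-rawSemiring = record
  { Carrier = ℤ[x]
  ; _≈_     = _≈_
  ; _+_     = _+_
  ; _*_     = _*_
  ; 0#      = []
  ; 1#      = const 1ℤ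
  }

-- Irreducible f: f is not a unit, and f ≈ g * h only if g or h is a unit
-- (units being the divisors of 1). The zero polynomial is excluded by 0 ≈ 0 * 0.
open import Algebra.Definitions.RawSemiring ℤ[x]-rawSemiring public using (Irreducible)

NonConstant : ℤ[x] → Set
NonConstant f = ¬ (∃ λ c → f ≈ const c)

-- d is the greatest common divisor of the (possibly infinite) family v.
record IsGCD {I : Set} (v : I → ℤ) (d : ℕ) : Set where
  field
    commonDivisor : ∀ i → + d ∣ v i
    greatest      : ∀ {c} → (∀ i → c ∣ v i) → c ∣ + d

Proper : ℤ[x] → Set
Proper f = NonConstant f × IsGCD (eval f) 1

-- The list of digits, like the list of coefficients, has its 0-th entry first.
digitPolynomial : ∀ {b} → Expansion b → ℤ[x]
digitPolynomial = map (λ a → + toℕ a)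

{-# OPTIONS --safe #-}

-- A common divisor of the values of f divides f(b) = p, so it is 1 or p. If it
-- is p, then p ∣ f(0) = a₀; as f is non-constant, a₀ < b ≤ p and so a₀ = 0.
-- Thus f = x g, and irreducibility makes g a unit, since x vanishes at 0.
-- Then f(1) = g(1) is a unit too, which contradicts p ∣ f(1).
module Submission where

open import Defs
open import Data.Digit using (Expansion; fromDigits)
open import Data.Fin.Base using (toℕ)
open import Data.Fin.Properties using (toℕ<n)
open import Data.Integer.Base using (+_; 0ℤ; 1ℤ; ∣_∣)
  renaming (_+_ to _+ᶻ_; _*_ to _*ᶻ_)
open import Data.Integer.Divisibility using (_∣_; divides)
import Data.Integer.Properties as ℤ
open import Data.Integer.Tactic.RingSolver using (solve)
open import Data.List.Base using ([]; _∷_; map)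
open import Data.Nat.Base as ℕ using (ℕ; zero; suc; _≤_; NonZero)
import Data.Nat.Divisibility as ℕ
open import Data.Nat.Primality using (Prime; prime⇒irreducible; ¬prime[1])
import Data.Nat.Properties as ℕ
open import Data.Product.Base using (_,_)
open import Data.Sum.Base using (inj₁; inj₂)
open import Relation.Binary.PropositionalEquality
  using (_≡_; refl; sym; trans; cong; cong₂; subst; module ≡-Reasoning)
open import Relation.Nullary.Negation using (¬_; contradiction)
open import Algebra.Definitions.RawMagma using () renaming (_,_ to _,ˣ_)
open import Algebra.Definitions.RawSemiring ℤ[x]-rawSemiring
  using (mkIrred) renaming (_∣_ to _∣ˣ_)

open ≡-Reasoning

coeff-+ : ∀ f g i → coeff (f + g) i ≡ coeff f i +ᶻ coeff g i
coeff-+ []      g       i       = sym (ℤ.+-identityˡ (coeff g i))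
coeff-+ (a ∷ f) []      i       = sym (ℤ.+-identityʳ (coeff (a ∷ f) i))
coeff-+ (a ∷ f) (b ∷ g) zero    = refl
coeff-+ (a ∷ f) (b ∷ g) (suc i) = coeff-+ f g i

coeff-scale : ∀ c f i → coeff (map (c *ᶻ_) f) i ≡ c *ᶻ coeff f i
coeff-scale c []      i       = sym (ℤ.*-zeroʳ c)
coeff-scale c (a ∷ f) zero    = refl
coeff-scale c (a ∷ f) (suc i) = coeff-scale c f i

const-0≈[] : const 0ℤ ≈ []
const-0≈[] zero    = refl
const-0≈[] (suc i) = refl

eval-≈[] : ∀ f m → f ≈ [] → eval f m ≡ 0ℤ
eval-≈[] []      m f≈0 = refl
eval-≈[] (a ∷ f) m f≈0
  rewrite f≈0 0 | eval-≈[] f m (λ i → f≈0 (suc i)) | ℤ.*-zeroʳ m = refl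

-- `f ≈ g` does not fix the lengths of the lists. Once one list ends, the rest of the other consists
-- of zeros, and `eval-≈[]` takes over.
eval-cong : ∀ f g m → f ≈ g → eval f m ≡ eval g m
eval-cong []      g       m f≈g = sym (eval-≈[] g m (λ i → sym (f≈g i)))
eval-cong (a ∷ f) []      m f≈g = eval-≈[] (a ∷ f) m f≈g
eval-cong (a ∷ f) (b ∷ g) m f≈g =
  cong₂ (λ c v → c +ᶻ m *ᶻ v) (f≈g 0) (eval-cong f g m (λ i → f≈g (suc i)))

eval-+ : ∀ f g m → eval (f + g) m ≡ eval f m +ᶻ eval g m
eval-+ []      g       m = sym (ℤ.+-identityˡ (eval g m))
eval-+ (a ∷ f) []      m = sym (ℤ.+-identityʳ (eval (a ∷ f) m))
eval-+ (a ∷ f) (b ∷ g) m rewrite eval-+ f g m = distrib (eval f m) (eval g m)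
  -- The values are generalised to variables `u` and `v`, which the ring solver can treat as atoms.
  where
  distrib : ∀ u v → a +ᶻ b +ᶻ m *ᶻ (u +ᶻ v) ≡ a +ᶻ m *ᶻ u +ᶻ (b +ᶻ m *ᶻ v)
  distrib u v = solve (a ∷ b ∷ m ∷ u ∷ v ∷ [])

eval-scale : ∀ c f m → eval (map (c *ᶻ_) f) m ≡ c *ᶻ eval f m
eval-scale c []      m = sym (ℤ.*-zeroʳ c)
eval-scale c (a ∷ f) m rewrite eval-scale c f m = distrib (eval f m)
  where
  distrib : ∀ u → c *ᶻ a +ᶻ m *ᶻ (c *ᶻ u) ≡ c *ᶻ (a +ᶻ m *ᶻ u)
  distrib u = solve (a ∷ c ∷ m ∷ u ∷ [])

eval-* : ∀ f g m → eval (f * g) m ≡ eval f m *ᶻ eval g m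
eval-* []      g m = refl
eval-* (a ∷ f) g m
  rewrite eval-+ (map (a *ᶻ_) g) (0ℤ ∷ (f * g)) m
        | eval-scale a g m
        | eval-* f g m = distrib (eval f m) (eval g m)
  where
  distrib : ∀ u v → a *ᶻ v +ᶻ (0ℤ +ᶻ m *ᶻ (u *ᶻ v)) ≡ (a +ᶻ m *ᶻ u) *ᶻ v
  distrib u v = solve (a ∷ m ∷ u ∷ v ∷ [])

-- Evaluation at `m` respects products, by `eval-*`, so it carries the cofactor `q` of a unit to a
-- cofactor of its value.
∣1⇒eval∣1 : ∀ {f} → f ∣ˣ const 1ℤ → ∀ m → eval f m ∣ 1ℤ
∣1⇒eval∣1 {f} (q ,ˣ qf≈1) m = divides ∣ eval q m ∣ (begin
  1                                ≡⟨ cong (λ k → ∣ 1ℤ +ᶻ k ∣) (ℤ.*-zeroʳ m) ⟨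
  ∣ eval (const 1ℤ) m ∣            ≡⟨ cong ∣_∣ (eval-cong (q * f) (const 1ℤ) m qf≈1) ⟨
  ∣ eval (q * f) m ∣               ≡⟨ cong ∣_∣ (eval-* q f m) ⟩
  ∣ eval q m *ᶻ eval f m ∣         ≡⟨ ℤ.abs-* (eval q m) (eval f m) ⟩
  ∣ eval q m ∣ ℕ.* ∣ eval f m ∣    ∎)

X : ℤ[x]
X = 0ℤ ∷ 1ℤ ∷ []

X∤1 : ¬ (X ∣ˣ const 1ℤ)
-- The value of `X` at 0 is 0, which does not divide 1.
X∤1 X∣1 with () ← ℕ.0∣⇒≡0 (∣1⇒eval∣1 X∣1 0ℤ)

-- Puts a polynomial without constant term into the form of a product, to which irreducibility
-- applies. The two lists can differ in trailing zeros, hence the comparison by coefficients.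
X*-shift : ∀ g → (0ℤ ∷ g) ≈ X * g
X*-shift g zero = begin
  0ℤ                                        ≡⟨ ℤ.+-identityʳ (0ℤ *ᶻ coeff g 0) ⟨
  0ℤ *ᶻ coeff g 0 +ᶻ 0ℤ                     ≡⟨ cong (_+ᶻ 0ℤ) (coeff-scale 0ℤ g 0) ⟨
  coeff (map (0ℤ *ᶻ_) g) 0 +ᶻ 0ℤ            ≡⟨ coeff-+ (map (0ℤ *ᶻ_) g) (0ℤ ∷ (const 1ℤ * g)) 0 ⟨
  coeff (X * g) 0                           ∎
X*-shift g (suc i) = begin
  coeff g i                                 ≡⟨ ℤ.*-identityˡ (coeff g i) ⟨
  1ℤ *ᶻ coeff g i                           ≡⟨ ℤ.+-identityʳ _ ⟨
  -- The product `const 1ℤ * g` unfolds with a summand `0ℤ ∷ []`, which is `const 0ℤ`.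
  1ℤ *ᶻ coeff g i +ᶻ 0ℤ                     ≡⟨ cong₂ _+ᶻ_ (coeff-scale 1ℤ g i) (const-0≈[] i) ⟨
  coeff (map (1ℤ *ᶻ_) g) i +ᶻ coeff (const 0ℤ) i
                                            ≡⟨ coeff-+ (map (1ℤ *ᶻ_) g) (const 0ℤ) i ⟨
  coeff (const 1ℤ * g) i                    ≡⟨ ℤ.+-identityˡ _ ⟨
  0ℤ *ᶻ coeff g (suc i) +ᶻ coeff (const 1ℤ * g) i
                                            ≡⟨ cong (_+ᶻ coeff (const 1ℤ * g) i) (coeff-scale 0ℤ g (suc i)) ⟨
  coeff (map (0ℤ *ᶻ_) g) (suc i) +ᶻ coeff (const 1ℤ * g) i
                                            ≡⟨ coeff-+ (map (0ℤ *ᶻ_) g) (0ℤ ∷ (const 1ℤ * g)) (suc i) ⟨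
  coeff (X * g) (suc i)                     ∎

-- In the factorization `X * g` the factor `X` is no unit, so `g` is one. The point 1 is chosen
-- because `X` takes the value 1 there, so the product and `g` have the same value.
irreducible-shift⇒eval[1]∣1 : ∀ g → Irreducible (0ℤ ∷ g) → eval (0ℤ ∷ g) 1ℤ ∣ 1ℤ
irreducible-shift⇒eval[1]∣1 g (mkIrred _ split) with split {X} {g} (X*-shift g)
... | inj₁ X∣1 = contradiction X∣1 X∤1
... | inj₂ g∣1 = subst (λ v → ∣ v ∣ ℕ.∣ 1)
                   (sym (trans (ℤ.+-identityˡ (1ℤ *ᶻ eval g 1ℤ)) (ℤ.*-identityˡ (eval g 1ℤ))))
                   (∣1⇒eval∣1 g∣1 1ℤ)

eval-digitPolynomial : ∀ {b} (a : Expansion b) →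
                       eval (digitPolynomial a) (+ b) ≡ + fromDigits a
eval-digitPolynomial     []      = refl
eval-digitPolynomial {b} (d ∷ a) = cong (+ toℕ d +ᶻ_) (begin
  + b *ᶻ eval (digitPolynomial a) (+ b)    ≡⟨ cong (+ b *ᶻ_) (eval-digitPolynomial a) ⟩
  + b *ᶻ + fromDigits a                    ≡⟨ ℤ.pos-* b (fromDigits a) ⟨
  + (b ℕ.* fromDigits a)                   ≡⟨ cong +_ (ℕ.*-comm b (fromDigits a)) ⟩
  + (fromDigits a ℕ.* b)                   ∎)

-- Digits are nonnegative, so nothing can cancel in a vanishing sum.
fromDigits≡0⇒≈[] : ∀ {b} .{{_ : NonZero b}} (a : Expansion b) →
                   fromDigits a ≡ 0 → digitPolynomial a ≈ []
fromDigits≡0⇒≈[]     []      _  i       = refl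
fromDigits≡0⇒≈[]     (d ∷ a) eq zero    = cong +_ (ℕ.m+n≡0⇒m≡0 (toℕ d) eq)
fromDigits≡0⇒≈[] {b} (d ∷ a) eq (suc i) =
  fromDigits≡0⇒≈[] a (ℕ.m*n≡0⇒m≡0 (fromDigits a) b (ℕ.m+n≡0⇒n≡0 (toℕ d) eq)) i

∷-nonConstant⇒tail≉[] : ∀ {c f} → NonConstant (c ∷ f) → ¬ (f ≈ [])
∷-nonConstant⇒tail≉[] {c} nonConst f≈0 =
  nonConst (c , λ { zero → refl ; (suc i) → f≈0 i })

-- The digits after the first are not all 0, so they represent a number that is at least 1 and
-- enters the sum multiplied by `b`.
nonConstant⇒base≤fromDigits : ∀ {b} .{{_ : NonZero b}} (a : Expansion b) →
                              NonConstant (digitPolynomial a) → b ≤ fromDigits a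
nonConstant⇒base≤fromDigits []      nonConst =
  contradiction (0ℤ , λ i → sym (const-0≈[] i)) nonConst
nonConstant⇒base≤fromDigits {b} (d ∷ a) nonConst =
  ℕ.≤-trans (ℕ.m≤n*m b (fromDigits a)) (ℕ.m≤n+m _ (toℕ d))
  where
  instance
    fromDigits≢0 : NonZero (fromDigits a)
    fromDigits≢0 = ℕ.≢-nonZero λ eq →
      ∷-nonConstant⇒tail≉[] nonConst (fromDigits≡0⇒≈[] a eq)

p∤values : ∀ {p b} → Prime p → .{{_ : NonZero b}} → (a : Expansion b) →
           b ≤ p → NonConstant (digitPolynomial a) → Irreducible (digitPolynomial a) →
           ¬ (∀ m → + p ∣ eval (digitPolynomial a) m)
p∤values pr [] b≤p nonConst _ _ = nonConst (0ℤ , λ i → sym (const-0≈[] i))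
p∤values {p} pr (d ∷ a) b≤p nonConst irr p∣
  -- Abstracting `toℕ d` together with the facts that mention it turns `irr`, in the case `zero`,
  -- into irreducibility of a list headed by `0ℤ`.
  with toℕ d | toℕ<n d | irr | p∣ 1ℤ
     | subst (p ℕ.∣_) (cong ∣_∣ (ℤ.+-identityʳ (+ toℕ d))) (p∣ 0ℤ)
... | zero  | _   | irr₀ | p∣f[1] | _     =
  ¬prime[1] (subst Prime (ℕ.∣1⇒≡1 (ℕ.∣-trans p∣f[1] (irreducible-shift⇒eval[1]∣1 _ irr₀))) pr)
-- A positive multiple of `p` is at least `p`, hence at least `b`, too large for a digit.
... | suc k | k<b | _    | _      | p∣1+k =
  ℕ.<⇒≱ k<b (ℕ.≤-trans b≤p (ℕ.∣⇒≤ p∣1+k))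

proposition1 : (p : ℕ) → Prime p → (b : ℕ) → 2 ≤ b →
    (a : Expansion b) → fromDigits a ≡ p →
    NonConstant (digitPolynomial a) →
    Irreducible (digitPolynomial a) →
    Proper (digitPolynomial a)
proposition1 p pr b 2≤b a refl nonConst irr = nonConst , record
  { commonDivisor = λ m → ℕ.1∣ _
  ; greatest      = λ {c} → greatest {c}
  }
  where
  instance
    b≢0 : NonZero b
    b≢0 = ℕ.>-nonZero (ℕ.≤-trans (ℕ.n≤1+n 1) 2≤b)

  greatest : ∀ {c} → (∀ m → c ∣ eval (digitPolynomial a) m) → c ∣ + 1
  greatest {c} c∣
    -- Integer divisibility is divisibility of absolute values, so primality applies to `∣ c ∣`
    -- directly, whatever the sign of `c`.
    with prime⇒irreducible pr (subst (λ v → c ∣ v) (eval-digitPolynomial a) (c∣ (+ b)))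
  ... | inj₁ ∣c∣≡1 = ℕ.∣-reflexive ∣c∣≡1
  ... | inj₂ ∣c∣≡p = contradiction
    (λ m → subst (ℕ._∣ ∣ eval (digitPolynomial a) m ∣) ∣c∣≡p (c∣ m))
    (p∤values pr a (nonConstant⇒base≤fromDigits a nonConst) nonConst irr)
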